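{- The set of Gödel numbers of sentences of the language of arithmetic that are true in the standard model $\omega$ is not definable in $\omega$; that is, there is no formula $\tau(v_0)$ of the language of arithmetic, with at most the free variable $v_0$, such that for every $i\in\omega$, $\tau(i)$ is true in $\omega$ if and only if $i$ is the Gödel number of a sentence true in $\omega$.
   Context: Fix a standard first-order language of arithmetic (with equality, constant $0$, unary function symbol $s$, binary function symbols $+,\cdot$, order $\le$ primitive or defined) and a standard Gödel numbering of its formulas. $\omega$ is the standard model of arithmetic. Inside formulas, $i$ stands for the numeral $s\cdots s0$ ($i$ occurrences of $s$). -}

module Defs where

open import Level using (0ℓ)
open import Data.Bool using (if_then_else_)
open import Data.Empty using (⊥)
open import Data.Nat using (ℕ; zero; suc; _+_; _*_; _≤_; _≟_; _≤?_)
open import Data.Product using (∃-syntax; _×_)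
open import Data.Sum using (_⊎_)
open import Function.Bundles using (_⇔_)
open import Relation.Binary.PropositionalEquality using (_≡_; _≢_)
open import Relation.Nullary using (¬_; does; DoubleNegation)
open import Relation.Nullary.Decidable using (decidable-stable)
open import Relation.Unary using (Pred)

infixl 7 _⊗_
infixl 6 _⊕_
infix  5 _≈_ _≼_
infixr 5 ∼_
infixr 4 _⇒_
infix  3 _⊨_ ω⊨_

data Term : Set where
  var     : ℕ → Term
  𝟘       : Term
  s       : Term → Term
  _⊕_ _⊗_ : Term → Term → Term

-- ∧, ∨ and ∃ are the usual classical abbreviations.  Restricting the
-- primitives to ¬, ⇒ and ∀ makes satisfaction, defined below by Tarski's
-- clauses, stable under double negation (⊨-stable), so that it is classical
-- truth although the metatheory is constructive.
data Formula : Set where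
  _≈_ _≼_ : Term → Term → Formula
  ∼_      : Formula → Formula
  _⇒_     : Formula → Formula → Formula
  ∀′      : ℕ → Formula → Formula

Occurs : ℕ → Term → Set
Occurs k (var j) = j ≡ k
Occurs k 𝟘       = ⊥
Occurs k (s t)   = Occurs k t
Occurs k (t ⊕ u) = Occurs k t ⊎ Occurs k u
Occurs k (t ⊗ u) = Occurs k t ⊎ Occurs k u

Free : ℕ → Formula → Set
Free k (t ≈ u)  = Occurs k t ⊎ Occurs k u
Free k (t ≼ u)  = Occurs k t ⊎ Occurs k u
Free k (∼ φ)    = Free k φ
Free k (φ ⇒ ψ)  = Free k φ ⊎ Free k ψ
Free k (∀′ j φ) = j ≢ k × Free k φ

Sentence : Pred Formula 0ℓ
Sentence φ = ∀ k → ¬ Free k φ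

AtMostV₀Free : Pred Formula 0ℓ
AtMostV₀Free φ = ∀ k → Free k φ → k ≡ 0

numeral : ℕ → Term
numeral zero    = 𝟘
numeral (suc i) = s (numeral i)

substTerm : ℕ → Term → Term → Term
substTerm k r (var j) = if does (j ≟ k) then r else var j
substTerm k r 𝟘       = 𝟘
substTerm k r (s t)   = s (substTerm k r t)
substTerm k r (t ⊕ u) = substTerm k r t ⊕ substTerm k r u
substTerm k r (t ⊗ u) = substTerm k r t ⊗ substTerm k r u

-- Replaces the free occurrences of v_k by r.  Bound variables are not renamed,
-- so r should be closed; it is only used with numerals.
subst-var : ℕ → Term → Formula → Formula
subst-var k r (t ≈ u)  = substTerm k r t ≈ substTerm k r u
subst-var k r (t ≼ u)  = substTerm k r t ≼ substTerm k r u
subst-var k r (∼ φ)    = ∼ subst-var k r φ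
subst-var k r (φ ⇒ ψ)  = subst-var k r φ ⇒ subst-var k r ψ
subst-var k r (∀′ j φ) = if does (j ≟ k) then ∀′ j φ else ∀′ j (subst-var k r φ)

_⟨_⟩ : Formula → ℕ → Formula
τ ⟨ i ⟩ = subst-var 0 (numeral i) τ

Assignment : Set
Assignment = ℕ → ℕ

_[_↦_] : Assignment → ℕ → ℕ → Assignment
(ρ [ k ↦ n ]) j = if does (j ≟ k) then n else ρ j

eval : Assignment → Term → ℕ
eval ρ (var j) = ρ j
eval ρ 𝟘       = 0
eval ρ (s t)   = suc (eval ρ t)
eval ρ (t ⊕ u) = eval ρ t + eval ρ u
eval ρ (t ⊗ u) = eval ρ t * eval ρ u

_⊨_ : Assignment → Formula → Set
ρ ⊨ t ≈ u  = eval ρ t ≡ eval ρ u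
ρ ⊨ t ≼ u  = eval ρ t ≤ eval ρ u
ρ ⊨ ∼ φ    = ¬ (ρ ⊨ φ)
ρ ⊨ φ ⇒ ψ  = (ρ ⊨ φ) → (ρ ⊨ ψ)
ρ ⊨ ∀′ j φ = ∀ n → ρ [ j ↦ n ] ⊨ φ

ω⊨_ : Formula → Set
ω⊨ φ = ∀ ρ → ρ ⊨ φ

⊨-stable : ∀ ρ φ → DoubleNegation (ρ ⊨ φ) → (ρ ⊨ φ)
⊨-stable ρ (t ≈ u)  h   = decidable-stable (eval ρ t ≟ eval ρ u) h
⊨-stable ρ (t ≼ u)  h   = decidable-stable (eval ρ t ≤? eval ρ u) h
⊨-stable ρ (∼ φ)    h x = h (λ ¬x → ¬x x)
⊨-stable ρ (φ ⇒ ψ)  h x = ⊨-stable ρ ψ (λ ¬y → h (λ f → ¬y (f x)))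
⊨-stable ρ (∀′ j φ) h n = ⊨-stable (ρ [ j ↦ n ]) φ (λ ¬y → h (λ f → ¬y (f n)))

triangle : ℕ → ℕ
triangle zero    = 0
triangle (suc n) = suc n + triangle n

-- Cantor's pairing function, (a + b)(a + b + 1) / 2 + b.
pair : ℕ → ℕ → ℕ
pair a b = triangle (a + b) + b

-- Each expression is coded by the pair of a tag for its outermost symbol and
-- the code of its arguments; no tag is shared by terms and formulas.
⌜_⌝ᵗ : Term → ℕ
⌜ var j ⌝ᵗ = pair 0 j
⌜ 𝟘 ⌝ᵗ     = pair 1 0
⌜ s t ⌝ᵗ   = pair 2 ⌜ t ⌝ᵗ
⌜ t ⊕ u ⌝ᵗ = pair 3 (pair ⌜ t ⌝ᵗ ⌜ u ⌝ᵗ)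
⌜ t ⊗ u ⌝ᵗ = pair 4 (pair ⌜ t ⌝ᵗ ⌜ u ⌝ᵗ)

⌜_⌝ : Formula → ℕ
⌜ t ≈ u ⌝  = pair 5 (pair ⌜ t ⌝ᵗ ⌜ u ⌝ᵗ)
⌜ t ≼ u ⌝  = pair 6 (pair ⌜ t ⌝ᵗ ⌜ u ⌝ᵗ)
⌜ ∼ φ ⌝    = pair 7 ⌜ φ ⌝
⌜ φ ⇒ ψ ⌝  = pair 8 (pair ⌜ φ ⌝ ⌜ ψ ⌝)
⌜ ∀′ j φ ⌝ = pair 9 (pair j ⌜ φ ⌝)

Definable : Pred ℕ 0ℓ → Set
Definable X = ∃[ τ ] AtMostV₀Free τ × (∀ i → (ω⊨ τ ⟨ i ⟩) ⇔ X i)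

TrueSentenceCode : Pred ℕ 0ℓ
TrueSentenceCode i = ∃[ φ ] Sentence φ × (ω⊨ φ) × ⌜ φ ⌝ ≡ i

{-# OPTIONS --safe #-}

-- A definition τ of truth is refuted by a sentence G that holds exactly when τ
-- fails at its code.  Instead of substituting a numeral into δ(v₁), take
-- G = ∀v₁ (v₁ ≈ n ⇒ δ) with n = ⌜ δ ⌝: its code is obtained from n and from the
-- code of the numeral n by pairing alone.  Since 2 · pair a b is a polynomial in
-- a and b, pairing is expressed by atomic formulas, and the only recursion to be
-- arithmetised is n ↦ ⌜ numeral n ⌝ᵗ.  For it, finite sets are coded by pairs
-- (a , m), where x belongs to the set when 1 + (x + 1) m divides a: for m = N !
-- these moduli are pairwise coprime for x ≤ N, so every set of numbers up to N
-- has a code.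
module Submission where

open import Defs
open import Data.Bool using (true; false)
open import Data.List using (List; []; _∷_; filter; map; upTo)
open import Data.List.Membership.DecPropositional using () renaming (_∈?_ to member?)
open import Data.List.Membership.Propositional using (_∈_)
open import Data.List.Membership.Propositional.Properties
  using (∈-filter⁺; ∈-filter⁻; ∈-map⁺; ∈-upTo⁺; ∈-upTo⁻)
open import Data.List.Relation.Unary.Any using (here; there)
open import Data.Maybe as Maybe using (Maybe; just; from-just)
open import Data.Nat
open import Data.Nat.Coprimality as Coprimality using (Coprime; coprime-divisor)
open import Data.Nat.Divisibility
open import Data.Nat.ListAction using (product)
open import Data.Nat.ListAction.Properties using (∈⇒∣product)
open import Data.Nat.Properties
open import Data.Nat.Tactic.RingSolver using (solve-∀)
open import Data.Product using (∃-syntax; _×_; _,_; proj₁; proj₂)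
open import Data.Sum using (_⊎_; inj₁; inj₂; [_,_]′)
open import Function using (_∘_; id)
open import Function.Bundles using (_⇔_; mk⇔; Equivalence)
open import Relation.Binary using (tri<; tri≈; tri>)
open import Relation.Binary.PropositionalEquality
open import Relation.Nullary using (¬_; yes; no; does; proof; ofʸ; ofⁿ; contradiction)
open import Relation.Nullary.Decidable using (dec⇒maybe; decidable-stable; map′)
open import Relation.Unary using (Pred; Decidable)

open Equivalence using (to; from)

-- Pairing and injectivity of the Gödel numbering

doublePair : ℕ → ℕ → ℕ
doublePair a b = (a + b) * suc (a + b) + (b + b)

triangle-double : ∀ n → triangle n + triangle n ≡ n * suc n
triangle-double zero    = refl
triangle-double (suc n) = begin
  (suc n + triangle n) + (suc n + triangle n) ≡⟨ rearrange (suc n) (triangle n) ⟩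
  (suc n + suc n) + (triangle n + triangle n) ≡⟨ cong (suc n + suc n +_) (triangle-double n) ⟩
  (suc n + suc n) + n * suc n                 ≡⟨ factor n ⟩
  suc n * suc (suc n)                         ∎
  where
  open ≡-Reasoning
  rearrange : ∀ a t → (a + t) + (a + t) ≡ (a + a) + (t + t)
  rearrange = solve-∀
  factor : ∀ n → (suc n + suc n) + n * suc n ≡ suc n * suc (suc n)
  factor = solve-∀

pair-double : ∀ a b → pair a b + pair a b ≡ doublePair a b
pair-double a b = begin
  (triangle (a + b) + b) + (triangle (a + b) + b) ≡⟨ rearrange (triangle (a + b)) b ⟩
  (triangle (a + b) + triangle (a + b)) + (b + b) ≡⟨ cong (_+ (b + b)) (triangle-double (a + b)) ⟩
  doublePair a b                                  ∎
  where
  open ≡-Reasoning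
  rearrange : ∀ t b → (t + b) + (t + b) ≡ (t + t) + (b + b)
  rearrange = solve-∀

double-injective : ∀ {x y} → x + x ≡ y + y → x ≡ y
double-injective {x} {y} eq with <-cmp x y
... | tri< x<y _ _ = contradiction eq (<⇒≢ (+-mono-< x<y x<y))
... | tri≈ _ x≡y _ = x≡y
... | tri> _ _ y<x = contradiction (sym eq) (<⇒≢ (+-mono-< y<x y<x))

halve : ∀ x a b → x + x ≡ doublePair a b → x ≡ pair a b
halve x a b eq = double-injective (trans eq (sym (pair-double a b)))

triangle-mono-≤ : ∀ {m n} → m ≤ n → triangle m ≤ triangle n
triangle-mono-≤ z≤n       = z≤n
triangle-mono-≤ (s≤s m≤n) = +-mono-≤ (s≤s m≤n) (triangle-mono-≤ m≤n)

-- Since `b` is less than `suc (a + b)`, a code stays below the next triangle number, where the next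
-- diagonal starts.
pair-<-diagonal : ∀ a b c d → a + b < c + d → pair a b < pair c d
pair-<-diagonal a b c d a+b<c+d = begin-strict
  triangle (a + b) + b                <⟨ +-monoʳ-< (triangle (a + b)) (s≤s (m≤n+m b a)) ⟩
  triangle (a + b) + suc (a + b)      ≡⟨ +-comm (triangle (a + b)) (suc (a + b)) ⟩
  triangle (suc (a + b))              ≤⟨ triangle-mono-≤ a+b<c+d ⟩
  triangle (c + d)                    ≤⟨ m≤m+n (triangle (c + d)) d ⟩
  triangle (c + d) + d                ∎
  where open ≤-Reasoning

pair-injective : ∀ a b c d → pair a b ≡ pair c d → a ≡ c × b ≡ d
pair-injective a b c d eq with <-cmp (a + b) (c + d)
... | tri< lt _ _ = contradiction eq (<⇒≢ (pair-<-diagonal a b c d lt))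
... | tri> _ _ gt = contradiction (sym eq) (<⇒≢ (pair-<-diagonal c d a b gt))
... | tri≈ _ a+b≡c+d _ = +-cancelʳ-≡ b a c (trans a+b≡c+d (cong (c +_) (sym b≡d))) , b≡d
  where
  b≡d : b ≡ d
  b≡d = +-cancelˡ-≡ (triangle (a + b)) b d
          (trans eq (cong (λ n → triangle n + d) (sym a+b≡c+d)))

doublePair-injective : ∀ a b c d → doublePair a b ≡ doublePair c d → a ≡ c × b ≡ d
doublePair-injective a b c d eq =
  pair-injective a b c d (halve _ c d (trans (pair-double a b) eq))

doublePair-mono-≤ : ∀ {a b c d} → a ≤ c → b ≤ d → doublePair a b ≤ doublePair c d
doublePair-mono-≤ a≤c b≤d =
  +-mono-≤ (*-mono-≤ (+-mono-≤ a≤c b≤d) (s≤s (+-mono-≤ a≤c b≤d))) (+-mono-≤ b≤d b≤d)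

fst≤doublePair : ∀ a b → a ≤ doublePair a b
fst≤doublePair a b = begin
  a                      ≤⟨ m≤m+n a b ⟩
  a + b                  ≤⟨ m≤m*n (a + b) (suc (a + b)) ⟩
  (a + b) * suc (a + b)  ≤⟨ m≤m+n _ (b + b) ⟩
  doublePair a b         ∎
  where open ≤-Reasoning

tagᵗ bodyᵗ : Term → ℕ
tagᵗ (var j) = 0
tagᵗ 𝟘       = 1
tagᵗ (s t)   = 2
tagᵗ (t ⊕ u) = 3
tagᵗ (t ⊗ u) = 4
bodyᵗ (var j) = j
bodyᵗ 𝟘       = 0
bodyᵗ (s t)   = ⌜ t ⌝ᵗ
bodyᵗ (t ⊕ u) = pair ⌜ t ⌝ᵗ ⌜ u ⌝ᵗ
bodyᵗ (t ⊗ u) = pair ⌜ t ⌝ᵗ ⌜ u ⌝ᵗ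

⌜⌝ᵗ-pair : ∀ t → ⌜ t ⌝ᵗ ≡ pair (tagᵗ t) (bodyᵗ t)
⌜⌝ᵗ-pair (var j) = refl
⌜⌝ᵗ-pair 𝟘       = refl
⌜⌝ᵗ-pair (s t)   = refl
⌜⌝ᵗ-pair (t ⊕ u) = refl
⌜⌝ᵗ-pair (t ⊗ u) = refl

⌜⌝ᵗ-split : ∀ t u → ⌜ t ⌝ᵗ ≡ ⌜ u ⌝ᵗ → tagᵗ t ≡ tagᵗ u × bodyᵗ t ≡ bodyᵗ u
⌜⌝ᵗ-split t u eq = pair-injective (tagᵗ t) (bodyᵗ t) (tagᵗ u) (bodyᵗ u)
  (trans (sym (⌜⌝ᵗ-pair t)) (trans eq (⌜⌝ᵗ-pair u)))

⌜⌝ᵗ-injective : ∀ t u → ⌜ t ⌝ᵗ ≡ ⌜ u ⌝ᵗ → t ≡ u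
-- Tags are literals, so matching their equality with `refl` rules out different outermost symbols
-- and leaves one case per constructor.
⌜⌝ᵗ-injective′ : ∀ t u → tagᵗ t ≡ tagᵗ u → bodyᵗ t ≡ bodyᵗ u → t ≡ u

⌜⌝ᵗ-injective t u eq =
  ⌜⌝ᵗ-injective′ t u (proj₁ (⌜⌝ᵗ-split t u eq)) (proj₂ (⌜⌝ᵗ-split t u eq))

⌜⌝ᵗ-injective′ (var i) (var j)   refl eq = cong var eq
⌜⌝ᵗ-injective′ 𝟘       𝟘         refl eq = refl
⌜⌝ᵗ-injective′ (s t)   (s t′)    refl eq = cong s (⌜⌝ᵗ-injective t t′ eq)
⌜⌝ᵗ-injective′ (t ⊕ u) (t′ ⊕ u′) refl eq with eq₁ , eq₂ ← pair-injective _ _ _ _ eq =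
  cong₂ _⊕_ (⌜⌝ᵗ-injective t t′ eq₁) (⌜⌝ᵗ-injective u u′ eq₂)
⌜⌝ᵗ-injective′ (t ⊗ u) (t′ ⊗ u′) refl eq with eq₁ , eq₂ ← pair-injective _ _ _ _ eq =
  cong₂ _⊗_ (⌜⌝ᵗ-injective t t′ eq₁) (⌜⌝ᵗ-injective u u′ eq₂)

tag body : Formula → ℕ
tag (t ≈ u)  = 5
tag (t ≼ u)  = 6
tag (∼ φ)    = 7
tag (φ ⇒ ψ)  = 8
tag (∀′ j φ) = 9
body (t ≈ u)  = pair ⌜ t ⌝ᵗ ⌜ u ⌝ᵗ
body (t ≼ u)  = pair ⌜ t ⌝ᵗ ⌜ u ⌝ᵗ
body (∼ φ)    = ⌜ φ ⌝
body (φ ⇒ ψ)  = pair ⌜ φ ⌝ ⌜ ψ ⌝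
body (∀′ j φ) = pair j ⌜ φ ⌝

⌜⌝-pair : ∀ φ → ⌜ φ ⌝ ≡ pair (tag φ) (body φ)
⌜⌝-pair (t ≈ u)  = refl
⌜⌝-pair (t ≼ u)  = refl
⌜⌝-pair (∼ φ)    = refl
⌜⌝-pair (φ ⇒ ψ)  = refl
⌜⌝-pair (∀′ j φ) = refl

⌜⌝-split : ∀ φ ψ → ⌜ φ ⌝ ≡ ⌜ ψ ⌝ → tag φ ≡ tag ψ × body φ ≡ body ψ
⌜⌝-split φ ψ eq = pair-injective (tag φ) (body φ) (tag ψ) (body ψ)
  (trans (sym (⌜⌝-pair φ)) (trans eq (⌜⌝-pair ψ)))

⌜⌝-injective : ∀ φ ψ → ⌜ φ ⌝ ≡ ⌜ ψ ⌝ → φ ≡ ψ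
⌜⌝-injective′ : ∀ φ ψ → tag φ ≡ tag ψ → body φ ≡ body ψ → φ ≡ ψ

⌜⌝-injective φ ψ eq =
  ⌜⌝-injective′ φ ψ (proj₁ (⌜⌝-split φ ψ eq)) (proj₂ (⌜⌝-split φ ψ eq))

⌜⌝-injective′ (t ≈ u)  (t′ ≈ u′)  refl eq with eq₁ , eq₂ ← pair-injective _ _ _ _ eq =
  cong₂ _≈_ (⌜⌝ᵗ-injective t t′ eq₁) (⌜⌝ᵗ-injective u u′ eq₂)
⌜⌝-injective′ (t ≼ u)  (t′ ≼ u′)  refl eq with eq₁ , eq₂ ← pair-injective _ _ _ _ eq =
  cong₂ _≼_ (⌜⌝ᵗ-injective t t′ eq₁) (⌜⌝ᵗ-injective u u′ eq₂)
⌜⌝-injective′ (∼ φ)    (∼ φ′)     refl eq = cong ∼_ (⌜⌝-injective φ φ′ eq)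
⌜⌝-injective′ (φ ⇒ ψ)  (φ′ ⇒ ψ′)  refl eq with eq₁ , eq₂ ← pair-injective _ _ _ _ eq =
  cong₂ _⇒_ (⌜⌝-injective φ φ′ eq₁) (⌜⌝-injective ψ ψ′ eq₂)
⌜⌝-injective′ (∀′ j φ) (∀′ j′ φ′) refl eq with eq₁ , eq₂ ← pair-injective _ _ _ _ eq =
  cong₂ ∀′ eq₁ (⌜⌝-injective φ φ′ eq₂)

-- Satisfaction: coincidence and substitution

_≗[_]_ : Assignment → Formula → Assignment → Set
ρ ≗[ φ ] σ = ∀ k → Free k φ → ρ k ≡ σ k

eval-cong : ∀ {ρ σ} t → (∀ k → Occurs k t → ρ k ≡ σ k) → eval ρ t ≡ eval σ t
eval-cong (var j) h = h j refl
eval-cong 𝟘       h = refl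
eval-cong (s t)   h = cong suc (eval-cong t h)
eval-cong (t ⊕ u) h = cong₂ _+_ (eval-cong t (λ k → h k ∘ inj₁)) (eval-cong u (λ k → h k ∘ inj₂))
eval-cong (t ⊗ u) h = cong₂ _*_ (eval-cong t (λ k → h k ∘ inj₁)) (eval-cong u (λ k → h k ∘ inj₂))

↦-cong : ∀ {ρ σ} j n φ → ρ ≗[ ∀′ j φ ] σ → (ρ [ j ↦ n ]) ≗[ φ ] (σ [ j ↦ n ])
↦-cong j n φ h k k∈φ with does (k ≟ j) | proof (k ≟ j)
... | true  | _       = refl
... | false | ofⁿ k≢j = h k ((k≢j ∘ sym) , k∈φ)

⊨-cong : ∀ {ρ σ} φ → ρ ≗[ φ ] σ → ρ ⊨ φ → σ ⊨ φ
⊨-cong (t ≈ u) h = subst₂ _≡_ (eval-cong t (λ k → h k ∘ inj₁)) (eval-cong u (λ k → h k ∘ inj₂))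
⊨-cong (t ≼ u) h = subst₂ _≤_ (eval-cong t (λ k → h k ∘ inj₁)) (eval-cong u (λ k → h k ∘ inj₂))
⊨-cong (∼ φ) h ¬p p = ¬p (⊨-cong φ (λ k → sym ∘ h k) p)
⊨-cong (φ ⇒ ψ) h f p =
  ⊨-cong ψ (λ k → h k ∘ inj₂) (f (⊨-cong φ (λ k → sym ∘ h k ∘ inj₁) p))
⊨-cong (∀′ j φ) h f n = ⊨-cong φ (↦-cong j n φ h) (f n)

eval-numeral : ∀ ρ i → eval ρ (numeral i) ≡ i
eval-numeral ρ zero    = refl
eval-numeral ρ (suc i) = cong suc (eval-numeral ρ i)

numeral-closed : ∀ i {k} → ¬ Occurs k (numeral i)
numeral-closed (suc i) = numeral-closed i

eval-subst : ∀ ρ k i t → eval ρ (substTerm k (numeral i) t) ≡ eval (ρ [ k ↦ i ]) t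
eval-subst ρ k i (var j) with does (j ≟ k)
... | true  = eval-numeral ρ i
... | false = refl
eval-subst ρ k i 𝟘       = refl
eval-subst ρ k i (s t)   = cong suc (eval-subst ρ k i t)
eval-subst ρ k i (t ⊕ u) = cong₂ _+_ (eval-subst ρ k i t) (eval-subst ρ k i u)
eval-subst ρ k i (t ⊗ u) = cong₂ _*_ (eval-subst ρ k i t) (eval-subst ρ k i u)

↦-overwrite : ∀ ρ k m n l → (ρ [ k ↦ m ] [ k ↦ n ]) l ≡ (ρ [ k ↦ n ]) l
↦-overwrite ρ k m n l with does (l ≟ k)
... | true  = refl
... | false = refl

↦-comm : ∀ ρ {j k} m n → j ≢ k → ∀ l →
         (ρ [ j ↦ m ] [ k ↦ n ]) l ≡ (ρ [ k ↦ n ] [ j ↦ m ]) l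
↦-comm ρ {j} {k} m n j≢k l
  with does (l ≟ j) | proof (l ≟ j) | does (l ≟ k) | proof (l ≟ k)
... | true  | ofʸ refl | true  | ofʸ refl = contradiction refl j≢k
... | true  | _        | false | _        = refl
... | false | _        | true  | _        = refl
... | false | _        | false | _        = refl

-- No capture can occur: a numeral has the same value under every assignment, so it may pass under
-- any quantifier.
⊨-subst : ∀ ρ k i φ → (ρ ⊨ subst-var k (numeral i) φ) ⇔ (ρ [ k ↦ i ] ⊨ φ)
⊨-subst ρ k i (t ≈ u) rewrite eval-subst ρ k i t | eval-subst ρ k i u = mk⇔ id id
⊨-subst ρ k i (t ≼ u) rewrite eval-subst ρ k i t | eval-subst ρ k i u = mk⇔ id id
⊨-subst ρ k i (∼ φ) = mk⇔ (_∘ from (⊨-subst ρ k i φ)) (_∘ to (⊨-subst ρ k i φ))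
⊨-subst ρ k i (φ ⇒ ψ) = mk⇔
  (λ f → to (⊨-subst ρ k i ψ) ∘ f ∘ from (⊨-subst ρ k i φ))
  (λ f → from (⊨-subst ρ k i ψ) ∘ f ∘ to (⊨-subst ρ k i φ))
⊨-subst ρ k i (∀′ j φ) with does (j ≟ k) | proof (j ≟ k)
... | true  | ofʸ refl = mk⇔
  (λ f n → ⊨-cong φ (λ l _ → sym (↦-overwrite ρ k i n l)) (f n))
  (λ f n → ⊨-cong φ (λ l _ → ↦-overwrite ρ k i n l) (f n))
... | false | ofⁿ j≢k = mk⇔
  (λ f n → ⊨-cong φ (λ l _ → ↦-comm ρ n i j≢k l) (to (⊨-subst (ρ [ j ↦ n ]) k i φ) (f n)))
  (λ f n → from (⊨-subst (ρ [ j ↦ n ]) k i φ) (⊨-cong φ (λ l _ → sym (↦-comm ρ n i j≢k l)) (f n)))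

-- Bounding the free variables by computation

VarsIn : List ℕ → Term → Set
VarsIn xs t = ∀ k → Occurs k t → k ∈ xs

FreeIn : List ℕ → Formula → Set
FreeIn xs φ = ∀ k → Free k φ → k ∈ xs

either : {P Q R : ℕ → Set} → (∀ k → P k → R k) → (∀ k → Q k → R k) →
         ∀ k → P k ⊎ Q k → R k
either p q k = [ p k , q k ]′

∀-freeIn : ∀ {xs} j φ → FreeIn (j ∷ xs) φ → FreeIn xs (∀′ j φ)
∀-freeIn j φ h k (j≢k , k∈φ) with h k k∈φ
... | here k≡j   = contradiction (sym k≡j) j≢k
... | there k∈xs = k∈xs

varsIn? : ∀ xs t → Maybe (VarsIn xs t)
varsIn? xs (var j) = Maybe.map (λ { j∈xs k refl → j∈xs }) (dec⇒maybe (member? _≟_ j xs))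
varsIn? xs 𝟘       = just λ _ ()
varsIn? xs (s t)   = varsIn? xs t
varsIn? xs (t ⊕ u) = Maybe.zipWith either (varsIn? xs t) (varsIn? xs u)
varsIn? xs (t ⊗ u) = Maybe.zipWith either (varsIn? xs t) (varsIn? xs u)

freeIn? : ∀ xs φ → Maybe (FreeIn xs φ)
freeIn? xs (t ≈ u)  = Maybe.zipWith either (varsIn? xs t) (varsIn? xs u)
freeIn? xs (t ≼ u)  = Maybe.zipWith either (varsIn? xs t) (varsIn? xs u)
freeIn? xs (∼ φ)    = freeIn? xs φ
freeIn? xs (φ ⇒ ψ)  = Maybe.zipWith either (freeIn? xs φ) (freeIn? xs ψ)
freeIn? xs (∀′ j φ) = Maybe.map (∀-freeIn j φ) (freeIn? (j ∷ xs) φ)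

-- Coding finite sets by divisibility

modulus : ℕ → ℕ → ℕ
modulus m x = suc (suc x * m)

infix 4 _∈⟨_,_⟩
_∈⟨_,_⟩ : ℕ → ℕ → ℕ → Set
x ∈⟨ a , m ⟩ = modulus m x ∣ a

≤⇒∣! : ∀ {d N} → suc d ≤ N → suc d ∣ N !
≤⇒∣! {d} d<N = ∣-trans (m∣m*n (d !)) (m≤n⇒m!∣n! d<N)

-- With `m = N !`, the combination `suc y * modulus m x - suc x * modulus m y` equals `y -
-- x`. A common divisor therefore divides `y - x`, hence `N !`, hence 1.
modulus-coprime-< : ∀ {N x y} → x < y → y ≤ N → Coprime (modulus (N !) x) (modulus (N !) y)
modulus-coprime-< {N} {x} {y} x<y y≤N {d} (d∣px , d∣py) =
  ∣1⇒≡1 (∣m+n∣m⇒∣n (subst (d ∣_) (+-comm 1 (suc x * m)) d∣px) (∣n⇒∣m*n (suc x) d∣m))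
  where
  m e : ℕ
  m = N !
  e = y ∸ suc x
  y≡ : y ≡ suc (x + e)
  y≡ = sym (m+[n∸m]≡n x<y)
  combination : ∀ x e m → suc (suc (x + e)) * suc (suc x * m)
                        ≡ suc x * suc (suc (suc (x + e)) * m) + suc e
  combination = solve-∀
  d∣sum : d ∣ suc x * modulus m y + suc e
  d∣sum = subst (d ∣_)
    (trans (combination x e m) (cong (λ z → suc x * modulus m z + suc e) (sym y≡)))
    (∣n⇒∣m*n (suc (suc (x + e))) d∣px)
  d∣m : d ∣ m
  d∣m = ∣-trans (∣m+n∣m⇒∣n d∣sum (∣n⇒∣m*n (suc x) d∣py))
                (≤⇒∣! (≤-trans (subst (suc e ≤_) (sym y≡) (s≤s (m≤n+m e x))) y≤N))

modulus-coprime : ∀ {N x y} → x ≤ N → y ≤ N → x ≢ y →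
                  Coprime (modulus (N !) x) (modulus (N !) y)
modulus-coprime {N} {x} {y} x≤N y≤N x≢y with <-cmp x y
... | tri< x<y _ _ = modulus-coprime-< {N} x<y y≤N
... | tri≈ _ x≡y _ = contradiction x≡y x≢y
... | tri> _ _ y<x = Coprimality.sym (modulus-coprime-< {N} y<x x≤N)

-- A factor belonging to another element is coprime to the modulus of `x` and can be cancelled. If
-- all were cancelled, the modulus would divide 1, although it exceeds 1 because `N !` is nonzero.
modulus-∣-product : ∀ {N x} xs → (∀ {y} → y ∈ xs → y ≤ N) → x ≤ N →
                    modulus (N !) x ∣ product (map (modulus (N !)) xs) → x ∈ xs
modulus-∣-product {N} {x} [] _ _ p∣1 =
  contradiction (suc-injective (∣1⇒≡1 p∣1)) (≢-nonZero⁻¹ (suc x * N !))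
  where instance
    _ = N !≢0
    _ = m*n≢0 (suc x) (N !)
modulus-∣-product {N} {x} (y ∷ xs) ≤N x≤N p∣ with x ≟ y
... | yes x≡y = here x≡y
... | no  x≢y = there (modulus-∣-product xs (≤N ∘ there) x≤N
  (coprime-divisor (modulus-coprime {N} x≤N (≤N (here refl)) x≢y) p∣))

set-code : ∀ {p} {P : Pred ℕ p} → Decidable P → ∀ N →
           ∃[ a ] ∃[ m ] (∀ {x} → x ≤ N → P x ⇔ (x ∈⟨ a , m ⟩))
set-code {P = P} P? N = product (map (modulus (N !)) xs) , N ! , λ x≤N → mk⇔
  (λ Px → ∈⇒∣product (∈-map⁺ (modulus (N !)) (∈-filter⁺ P? (∈-upTo⁺ (s≤s x≤N)) Px)))
  (λ x∈ → proj₂ (∈-filter⁻ P? {xs = upTo (suc N)} (modulus-∣-product xs bound x≤N x∈)))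
  where
  xs : List ℕ
  xs = filter P? (upTo (suc N))
  bound : ∀ {y} → y ∈ xs → y ≤ N
  bound y∈xs = s≤s⁻¹ (∈-upTo⁻ (proj₁ (∈-filter⁻ P? {xs = upTo (suc N)} y∈xs)))

-- The graph of n ↦ ⌜ numeral n ⌝ᵗ

doublePairᵗ : Term → Term → Term
doublePairᵗ t u = (t ⊕ u) ⊗ s (t ⊕ u) ⊕ (u ⊕ u)

isPair : Term → Term → Term → Formula
isPair r t u = r ⊕ r ≈ doublePairᵗ t u

-- v₃ and v₄ are the code (a , m) of a set.
contains : Term → Formula
contains t = ∼ ∀′ 9 (∼ (var 3 ≈ var 9 ⊗ s (s t ⊗ var 4)))

-- Holds when (v₁ , v₂) lies in every coded set that contains (0 , ⌜ 𝟘 ⌝ᵗ) and is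
-- closed under (k , ⌜ t ⌝ᵗ) ↦ (k + 1 , ⌜ s t ⌝ᵗ), as far as these pairs do not
-- exceed the bound v₅.  The bound is needed because coded sets are finite.
numeralCode : Formula
numeralCode = ∀′ 3 (∀′ 4 (∀′ 5 (base ⇒ step ⇒ bounded (var 1) (var 2) ⇒ holds (var 1) (var 2))))
  where
  bounded holds : Term → Term → Formula
  bounded t u = doublePairᵗ t u ≼ var 5
  holds t u = contains (doublePairᵗ t u)
  base step : Formula
  base = bounded 𝟘 (numeral ⌜ 𝟘 ⌝ᵗ) ⇒ holds 𝟘 (numeral ⌜ 𝟘 ⌝ᵗ)
  step = ∀′ 6 (∀′ 7 (∀′ 8 (isPair (var 8) (numeral 2) (var 7) ⇒ holds (var 6) (var 7) ⇒
           bounded (s (var 6)) (var 8) ⇒ holds (s (var 6)) (var 8))))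

Contains : ℕ → ℕ → ℕ → Set
Contains a m x = ¬ (∀ q → ¬ (a ≡ q * modulus m x))

-- `Contains` is what `contains` means under satisfaction, with the quotient doubly negated;
-- decidability of divisibility recovers it.
∈⇔Contains : ∀ a m x → x ∈⟨ a , m ⟩ ⇔ Contains a m x
∈⇔Contains a m x = mk⇔
  (λ { (divides q eq) h → h q eq })
  (λ h → decidable-stable (modulus m x ∣? a) λ x∉ → h λ q eq → x∉ (divides q eq))

numeralPair : ℕ → ℕ
numeralPair k = doublePair k ⌜ numeral k ⌝ᵗ

numeralPair-step : ∀ k → numeralPair k ≤ numeralPair (suc k)
numeralPair-step k = doublePair-mono-≤ (n≤1+n k) (m≤n+m _ (triangle (2 + ⌜ numeral k ⌝ᵗ)))

IsNumeralPair : Pred ℕ _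
IsNumeralPair x = ∃[ k ] x ≡ numeralPair k

-- A bounded search suffices, since `k` never exceeds `numeralPair k`.
isNumeralPair? : Decidable IsNumeralPair
isNumeralPair? x = map′
  (λ (k , _ , eq) → k , eq)
  (λ { (k , refl) → k , s≤s (fst≤doublePair k ⌜ numeral k ⌝ᵗ) , refl })
  (anyUpTo? (λ k → x ≟ numeralPair k) (suc x))

numeralPair⇒code : ∀ k d → IsNumeralPair (doublePair k d) → d ≡ ⌜ numeral k ⌝ᵗ
numeralPair⇒code k d (j , eq) with refl , d≡ ← doublePair-injective k d j _ eq = d≡

-- Induction from 0 up to `ρ 1` puts each successive pair into the set. The bound holds throughout
-- because `numeralPair` is monotone.
numeralCode-complete : ∀ ρ → ρ 2 ≡ ⌜ numeral (ρ 1) ⌝ᵗ → ρ ⊨ numeralCode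
numeralCode-complete ρ eq a m B base step rewrite eq = go (ρ 1)
  where
  go : ∀ k → numeralPair k ≤ B → Contains a m (numeralPair k)
  go zero    = base
  go (suc k) le = step k _ _ (pair-double 2 ⌜ numeral k ⌝ᵗ)
                    (go k (≤-trans (numeralPair-step k) le)) le

-- The formula is applied to a code of the true graph, cut off at the pair in question. This set is
-- closed as required, so the pair belongs to it and thus to the graph.
numeralCode-sound : ∀ ρ → ρ ⊨ numeralCode → ρ 2 ≡ ⌜ numeral (ρ 1) ⌝ᵗ
numeralCode-sound ρ h with a , m , code ← set-code isNumeralPair? (doublePair (ρ 1) (ρ 2)) =
  numeralPair⇒code (ρ 1) (ρ 2) (elim ≤-refl (h a m _ base step ≤-refl))
  where
  N : ℕ
  N = doublePair (ρ 1) (ρ 2)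
  intro : ∀ {x} → x ≤ N → IsNumeralPair x → Contains a m x
  intro {x} x≤N = to (∈⇔Contains a m x) ∘ to (code x≤N)
  elim : ∀ {x} → x ≤ N → Contains a m x → IsNumeralPair x
  elim {x} x≤N = from (code x≤N) ∘ from (∈⇔Contains a m x)
  base : numeralPair 0 ≤ N → Contains a m (numeralPair 0)
  base le = intro le (0 , refl)
  step : ∀ k d d′ → d′ + d′ ≡ doublePair 2 d → Contains a m (doublePair k d) →
         doublePair (suc k) d′ ≤ N → Contains a m (doublePair (suc k) d′)
  step k d d′ eq kd∈ le with refl ← halve d′ 2 d eq =
    intro le (suc k , cong (doublePair (suc k) ∘ pair 2) (numeralPair⇒code k d (elim kd≤N kd∈)))
    where
    kd≤N : doublePair k d ≤ N
    -- The code agrees with the graph only up to `N`; the earlier pair is in range because `d` is at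
    -- most `pair 2 d`.
    kd≤N = ≤-trans (doublePair-mono-≤ (n≤1+n k) (m≤n+m d (triangle (2 + d)))) le

-- Diagonalisation

diagonal : ℕ → Formula → Formula
diagonal n φ = ∀′ 1 (var 1 ≈ numeral n ⇒ φ)

guarded : List (ℕ × Formula) → Formula → Formula
guarded []             ψ = ψ
guarded ((j , θ) ∷ θs) ψ = ∀′ j (θ ⇒ guarded θs ψ)

-- The innermost formula will contain an arbitrary `τ`, on which `freeIn?` cannot compute, so its
-- check is passed in.
guarded-freeIn? : ∀ {ψ} → (∀ xs → Maybe (FreeIn xs ψ)) →
                  ∀ xs θs → Maybe (FreeIn xs (guarded θs ψ))
guarded-freeIn? ψ? xs []             = ψ? xs
guarded-freeIn? ψ? xs ((j , θ) ∷ θs) = Maybe.map (∀-freeIn j (θ ⇒ guarded θs _))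
  (Maybe.zipWith either (freeIn? (j ∷ xs) θ) (guarded-freeIn? ψ? (j ∷ xs) θs))

-- With v₁ = n = ⌜ φ ⌝ and v₂ = ⌜ numeral n ⌝ᵗ, the values of v₃, …, v₇, v₀ are the
-- successive pairs that build ⌜ diagonal n φ ⌝ from v₂ and n.
guards : List (ℕ × Formula)
guards
  = (2 , numeralCode)
  ∷ (3 , isPair (var 3) (numeral ⌜ var 1 ⌝ᵗ) (var 2))
  ∷ (4 , isPair (var 4) (numeral 5) (var 3))
  ∷ (5 , isPair (var 5) (var 4) (var 1))
  ∷ (6 , isPair (var 6) (numeral 8) (var 5))
  ∷ (7 , isPair (var 7) (numeral 1) (var 6))
  ∷ (0 , isPair (var 0) (numeral 9) (var 7))
  ∷ []

-- Each guard has exactly one solution, so the universal form agrees with the existential one: `τ`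
-- fails at the code of the diagonal sentence.
untrue : Formula → Formula
untrue τ = guarded guards (∼ τ)

-- Here 9, 8 and 5 are the tags of `∀′`, `⇒` and `≈`, and 1 is the index of the bound variable.
diagonalCode : (ℕ → ℕ → ℕ) → ℕ → ℕ
diagonalCode _∙_ n = 9 ∙ (1 ∙ (8 ∙ ((5 ∙ (⌜ var 1 ⌝ᵗ ∙ ⌜ numeral n ⌝ᵗ)) ∙ n)))

module _ (τ : Formula) (fv : AtMostV₀Free τ) where

  ⊨-v₀ : ∀ {ρ σ} → ρ 0 ≡ σ 0 → ρ ⊨ τ → σ ⊨ τ
  ⊨-v₀ {ρ} {σ} eq = ⊨-cong τ λ k k∈τ → subst (λ l → ρ l ≡ σ l) (sym (fv k k∈τ)) eq

  -- Abstracting from pair keeps the type checker from unfolding nested triangles.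
  module _ (_∙_ : ℕ → ℕ → ℕ) (∙-double : ∀ a b → a ∙ b + a ∙ b ≡ doublePair a b) where

    ∙-unique : ∀ x a b → x + x ≡ doublePair a b → x ≡ a ∙ b
    ∙-unique x a b eq = double-injective (trans eq (sym (∙-double a b)))

    diagonalCode-unique : ∀ n c e₁ e₂ e₃ e₄ e₅ e₆ → c ≡ ⌜ numeral n ⌝ᵗ →
      e₁ + e₁ ≡ doublePair ⌜ var 1 ⌝ᵗ c → e₂ + e₂ ≡ doublePair 5 e₁ →
      e₃ + e₃ ≡ doublePair e₂ n → e₄ + e₄ ≡ doublePair 8 e₃ →
      e₅ + e₅ ≡ doublePair 1 e₄ → e₆ + e₆ ≡ doublePair 9 e₅ → e₆ ≡ diagonalCode _∙_ n
    diagonalCode-unique n c e₁ e₂ e₃ e₄ e₅ e₆ refl eq₁ eq₂ eq₃ eq₄ eq₅ eq₆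
      with refl ← ∙-unique e₁ ⌜ var 1 ⌝ᵗ c eq₁
      with refl ← ∙-unique e₂ 5 e₁ eq₂
      with refl ← ∙-unique e₃ e₂ n eq₃
      with refl ← ∙-unique e₄ 8 e₃ eq₄
      with refl ← ∙-unique e₅ 1 e₄ eq₅ = ∙-unique e₆ 9 e₅ eq₆

    untrue-⊨ : ∀ ρ σ → σ 0 ≡ diagonalCode _∙_ (ρ 1) → (ρ ⊨ untrue τ) ⇔ (¬ (σ ⊨ τ))
    untrue-⊨ ρ σ σ0≡ = mk⇔
      -- Forwards, the intended values satisfy all guards; backwards, the guards force these values.
      (λ h σ⊨τ → h c (numeralCode-complete (ρ [ 2 ↦ c ]) refl)
        e₁ (∙-double ⌜ var 1 ⌝ᵗ c) e₂ (∙-double 5 e₁) e₃ (∙-double e₂ (ρ 1))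
        e₄ (∙-double 8 e₃) e₅ (∙-double 1 e₄) _ (∙-double 9 e₅) (⊨-v₀ σ0≡ σ⊨τ))
      (λ ¬σ⊨τ c num e₁ eq₁ e₂ eq₂ e₃ eq₃ e₄ eq₄ e₅ eq₅ e₆ eq₆ ρ⊨τ → ¬σ⊨τ (⊨-v₀
        (trans (diagonalCode-unique (ρ 1) c e₁ e₂ e₃ e₄ e₅ e₆
                 (numeralCode-sound (ρ [ 2 ↦ c ]) num) eq₁ eq₂ eq₃ eq₄ eq₅ eq₆)
               (sym σ0≡)) ρ⊨τ))
      where
      c e₁ e₂ e₃ e₄ e₅ : ℕ
      c  = ⌜ numeral (ρ 1) ⌝ᵗ
      e₁ = ⌜ var 1 ⌝ᵗ ∙ c
      e₂ = 5 ∙ e₁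
      e₃ = e₂ ∙ ρ 1
      e₄ = 8 ∙ e₃
      e₅ = 1 ∙ e₄

  v₀-freeIn? : ∀ xs → Maybe (FreeIn xs τ)
  v₀-freeIn? xs = Maybe.map (λ 0∈xs k k∈τ → subst (_∈ xs) (sym (fv k k∈τ)) 0∈xs)
                           (dec⇒maybe (member? _≟_ 0 xs))

  untrue-freeIn : FreeIn (1 ∷ []) (untrue τ)
  -- The check evaluates to `just` even for a variable `τ`: at `τ` it only looks for 0 in the list,
  -- and the last guard has put it there.
  untrue-freeIn = from-just (guarded-freeIn? {ψ = ∼ τ} v₀-freeIn? (1 ∷ []) guards)

diagonal-sentence : ∀ n φ → FreeIn (1 ∷ []) φ → Sentence (diagonal n φ)
diagonal-sentence n φ h k (1≢k , inj₁ (inj₁ 1≡k)) = 1≢k 1≡k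
diagonal-sentence n φ h k (1≢k , inj₁ (inj₂ k∈n)) = numeral-closed n k∈n
diagonal-sentence n φ h k (1≢k , inj₂ k∈φ) with here refl ← h k k∈φ = 1≢k refl

diagonal-⊨ : ∀ ρ n φ → (ρ ⊨ diagonal n φ) ⇔ (ρ [ 1 ↦ n ] ⊨ φ)
diagonal-⊨ ρ n φ = mk⇔
  (λ h → h n (sym (eval-numeral _ n)))
  (λ h m m≡n → subst (λ m → ρ [ 1 ↦ m ] ⊨ φ) (sym (trans m≡n (eval-numeral _ n))) h)

-- No code of a substitution has to be computed, so unfolding the numbering suffices.
diagonal-code : ∀ φ → ⌜ diagonal ⌜ φ ⌝ φ ⌝ ≡ diagonalCode pair ⌜ φ ⌝
diagonal-code φ = refl

-- The liar sentence and undefinability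

Liar : Formula → Formula → Set
Liar τ G = ∀ ρ → (ρ ⊨ G) ⇔ (¬ (ρ [ 0 ↦ ⌜ G ⌝ ] ⊨ τ))

diagonal-liar : ∀ τ δ →
  (∀ ρ σ → σ 0 ≡ diagonalCode pair (ρ 1) → (ρ ⊨ δ) ⇔ (¬ (σ ⊨ τ))) →
  Liar τ (diagonal ⌜ δ ⌝ δ)
diagonal-liar τ δ δ-⊨ ρ = mk⇔
  (to δ-⊨ρ ∘ to (diagonal-⊨ ρ ⌜ δ ⌝ δ))
  (from (diagonal-⊨ ρ ⌜ δ ⌝ δ) ∘ from δ-⊨ρ)
  where
  δ-⊨ρ : (ρ [ 1 ↦ ⌜ δ ⌝ ] ⊨ δ) ⇔ (¬ (ρ [ 0 ↦ ⌜ diagonal ⌜ δ ⌝ δ ⌝ ] ⊨ τ))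
  δ-⊨ρ = δ-⊨ (ρ [ 1 ↦ ⌜ δ ⌝ ]) (ρ [ 0 ↦ ⌜ diagonal ⌜ δ ⌝ δ ⌝ ]) (diagonal-code δ)

liar-refutes : ∀ τ G → AtMostV₀Free τ → Sentence G → Liar τ G →
               ¬ (∀ i → (ω⊨ τ ⟨ i ⟩) ⇔ TrueSentenceCode i)
liar-refutes τ G fv G-sentence liar defines =
  τ-fails (from (defines ⌜ G ⌝) (G , G-sentence , G-true , refl))
  where
  τ-fails : ¬ (ω⊨ τ ⟨ ⌜ G ⌝ ⟩)
  -- By injectivity the true sentence with this code is `G` itself, and `G` says that `τ` fails
  -- here.
  τ-fails τ⟨g⟩ with φ , _ , φ-true , eq ← to (defines ⌜ G ⌝) τ⟨g⟩ =
    to (liar ρ₀) (subst (ρ₀ ⊨_) (⌜⌝-injective φ G eq) (φ-true ρ₀))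
                 (to (⊨-subst ρ₀ 0 ⌜ G ⌝ τ) (τ⟨g⟩ ρ₀))
    where
    ρ₀ : Assignment
    ρ₀ _ = 0
  G-true : ω⊨ G
  -- Satisfaction of `τ` under one assignment extends to all, since only the value of the variable 0
  -- matters.
  G-true ρ = from (liar ρ) λ sat →
    τ-fails λ σ → from (⊨-subst σ 0 ⌜ G ⌝ τ) (⊨-v₀ τ fv refl sat)

corollary2 : ¬ Definable TrueSentenceCode
corollary2 (τ , fv , defines) = liar-refutes τ (diagonal ⌜ untrue τ ⌝ (untrue τ)) fv
  (diagonal-sentence ⌜ untrue τ ⌝ (untrue τ) (untrue-freeIn τ fv))
  (diagonal-liar τ (untrue τ) (untrue-⊨ τ fv pair pair-double))
  defines
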